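{- Let $c\ge 1$ be an integer and let $\mathcal{H}=\{(H_1,U_1),\dots,(H_m,U_m)\}$ be a finite family, where each $H_i$ is a finite simple graph and $U_i\subseteq V(H_i)$. Then $\mathcal{H}$ is a $c$-closed polynomial pattern family.
   Context: A graph is $c$-closed if any two distinct non-adjacent vertices have fewer than $c$ common neighbours. Given a graph $H$ with $V(H)=\{1,\dots,k\}$ and $U\subseteq V(H)$, a $U$-clique prescribed blow-up of $H$ is a graph whose vertex set is partitioned into nonempty sets $V_1\sqcup\dots\sqcup V_k$ such that $V_i$ is complete to $V_j$ whenever $ij\in E(H)$, and $V_i$ is a clique for every $i\in U$. For a graph $G$ and $S\subseteq V(G)$, $G[S]$ is a maximal such blow-up if $G[S]$ is one and no $S'$ with $S\subsetneq S'\subseteq V(G)$ has $G[S']$ one. A family $\mathcal{H}=\{(H_i,U_i)\}$ is a $c$-closed polynomial pattern family if there is a polynomial $f\in\mathbb{R}[x]$ such that for every $c$-closed graph $G$ on $n$ vertices and every $(H_i,U_i)\in\mathcal{H}$, the number of sets $S\subseteq V(G)$ with $G[S]$ a maximal $U_i$-clique prescribed blow-up of $H_i$ is at most $f(n)$. -}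

module Defs where

open import Data.Nat using (ℕ; _<_; _+_; _*_; _^_)
open import Data.Bool using (Bool; true; false; _∧_)
open import Data.Fin using (Fin)
open import Data.Fin.Subset using (Subset; _∈_; _⊂_; ∣_∣)
open import Data.Vec using (tabulate)
open import Data.List using (List; []; _∷_)
open import Data.Product using (Σ; _×_)
open import Relation.Binary.PropositionalEquality using (_≡_; _≢_)
open import Relation.Nullary using (¬_)

record Graph (n : ℕ) : Set where
  field
    adj     : Fin n → Fin n → Bool
    adj-sym : ∀ u v → adj u v ≡ adj v u
    irrefl  : ∀ v → adj v v ≡ false
open Graph public

Adj : ∀ {n} → Graph n → Fin n → Fin n → Set
Adj G u v = adj G u v ≡ true

commonNbrs : ∀ {n} → Graph n → Fin n → Fin n → ℕ
commonNbrs G u v = ∣ tabulate (λ w → adj G u w ∧ adj G v w) ∣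

CClosed : ℕ → ∀ {n} → Graph n → Set
CClosed c G = ∀ u v → u ≢ v → adj G u v ≡ false → commonNbrs G u v < c

record Pattern : Set where
  field
    k : ℕ
    H : Graph k
    U : Subset k
open Pattern public

-- G[S] is a U-clique prescribed blow-up of H: there is an assignment p of
-- the vertices of S to parts V_i = p⁻¹(i) ∩ S such that every part is
-- nonempty, V_i is complete to V_j for every edge ij of H, and V_i is a
-- clique for every i ∈ U.
IsBlowUp : ∀ {n} → Graph n → Pattern → Subset n → Set
IsBlowUp {n} G P S =
  Σ (Fin n → Fin (k P)) λ p →
      (∀ (i : Fin (k P)) → Σ (Fin n) λ v → v ∈ S × p v ≡ i)
    × (∀ u v → u ∈ S → v ∈ S → u ≢ v → Adj (H P) (p u) (p v) → Adj G u v)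
    × (∀ u v → u ∈ S → v ∈ S → u ≢ v → p u ≡ p v → p u ∈ U P → Adj G u v)

IsMaxBlowUp : ∀ {n} → Graph n → Pattern → Subset n → Set
IsMaxBlowUp G P S = IsBlowUp G P S × (∀ S′ → S ⊂ S′ → ¬ IsBlowUp G P S′)

Poly : Set
Poly = List ℕ

eval : Poly → ℕ → ℕ
eval []       x = 0
eval (a ∷ as) x = a + x * eval as x

{-# OPTIONS --safe #-}

-- In a c-closed graph, two distinct vertices with c common neighbours are
-- adjacent.  Let S carry a maximal blow-up with parts Vᵢ, and record for each
-- part a kind and a set Yᵢ of at most c of its vertices:
--   * small:  Yᵢ = Vᵢ;
--   * clique: Vᵢ is a clique and |Yᵢ| = c;
--   * free:   |Vᵢ| ≥ c and Vᵢ is not a clique; then Vⱼ is small whenever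
--             ij ∈ E(H), as two non-adjacent vertices of Vᵢ are complete to Vⱼ.
-- A common neighbour of the set Yᵢ of a clique part is adjacent to, or equal to,
-- every vertex of Vᵢ and of each Vⱼ with ij ∈ E(H), because these share Yᵢ with
-- it; so it could be added to Vᵢ and hence lies in S by maximality.  For a free
-- part, where i ∉ U, the same holds for the common neighbours of all Vⱼ with
-- ij ∈ E(H).  Thus S is a union of sets computed from the record, and there are
-- at most (3 nᶜ)ᵏ records.
module Submission where

open import Defs
open import Data.Bool using (_∧_)
open import Data.Bool.Properties as Bool using (¬-not)
open import Data.Empty using (⊥-elim)
open import Data.Fin using (Fin; zero; suc; combine; quotient; remainder; funToFin; finToFun)
open import Data.Fin.Properties
  using (_≟_; any?; injective⇒≤; remQuot-combine; finToFun-funToFin; suc-injective; 0≢1+n)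
open import Data.Fin.Subset using (Subset; _-_; _∪_; ⁅_⁆; ∣_∣; _⊂_) renaming (_∈_ to _∈ₛ_; _∉_ to _∉ₛ_)
open import Data.Fin.Subset.Properties
  using (_∈?_; ⊆-antisym; x∈⁅x⁆; x∈⁅y⁆⇒x≡y; p⊆p∪q; q⊆p∪q; x∈p∪q⁻; x∈p∧x≢y⇒x∈p-y; x∈p⇒∣p-x∣<∣p∣)
open import Data.List using (List; []; _∷_; length; lookup; replicate; _++_; map; foldr)
open import Data.List.Membership.Propositional using (_∈_)
open import Data.List.Membership.Propositional.Properties using (∈-lookup; ∈-map⁺)
open import Data.List.Relation.Unary.All as All using (All)
open import Data.List.Relation.Unary.Any using (here; there)
open import Data.List.Relation.Unary.AllPairs using (_∷_)
open import Data.List.Relation.Unary.Unique.Propositional using (Unique)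
open import Data.Nat using (ℕ; zero; suc; _+_; _*_; _^_; _≤_; z≤n; s≤s)
open import Data.Nat.Properties
  using (≤-trans; module ≤-Reasoning; <⇒≱; m≤m+n; m≤n+m; *-zeroʳ; *-identityʳ; +-identityʳ;
         ^-*-assoc; [m*n]*[o*p]≡[m*o]*[n*p])
open import Data.Nat.Tactic.RingSolver using (solve-∀)
open import Data.Product using (Σ; ∃; ∃₂; _×_; _,_; proj₁; proj₂)
open import Data.Sum using (_⊎_; inj₁; inj₂)
open import Data.Vec using (tabulate)
open import Data.Vec.Properties using (lookup∘tabulate; lookup⇒[]=)
open import Function using (_∘_; case_of_; Injective)
open import Level using (0ℓ)
open import Relation.Binary.PropositionalEquality
  using (_≡_; _≢_; _≗_; refl; sym; trans; cong; cong₂; subst; module ≡-Reasoning)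
open import Relation.Nullary using (¬_; Dec; yes; no; contradiction; ¬?; _×-dec_)
open import Relation.Nullary.Decidable using (decidable-stable)
open import Relation.Unary using (Pred; Decidable)

private variable
  m n c l : ℕ

-- Counting by codes and choosing points of a finite set.

lookup-injective : ∀ {A : Set} {xs : List A} → Unique xs → Injective _≡_ _≡_ (lookup xs)
lookup-injective (_    ∷ _) {zero}  {zero}  _  = refl
lookup-injective (x∉xs ∷ _) {zero}  {suc j} eq = contradiction eq (All.lookup x∉xs (∈-lookup j))
lookup-injective (x∉xs ∷ _) {suc i} {zero}  eq = contradiction (sym eq) (All.lookup x∉xs (∈-lookup i))
lookup-injective (_    ∷ u) {suc i} {suc j} eq = cong suc (lookup-injective u eq)

-- A relation suffices in place of a coding function: since a code determines at most one object,
-- any choice of codes is injective on the positions of a list without repetitions.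
length≤codes : ∀ {A : Set} (_Codes_ : Fin m → A → Set) →
               (∀ {a x y} → a Codes x → a Codes y → x ≡ y) →
               {xs : List A} → Unique xs → All (λ x → ∃ (_Codes x)) xs → length xs ≤ m
length≤codes _Codes_ det {xs} unique coded = injective⇒≤ {f = proj₁ ∘ code} λ {i} {j} eq →
  lookup-injective unique
    (det (proj₂ (code i)) (subst (_Codes lookup xs j) (sym eq) (proj₂ (code j))))
  where
  code : ∀ i → ∃ (_Codes lookup xs i)
  code i = All.lookup coded (∈-lookup i)

injective⇒≤∣∣ : (T : Subset n) (f : Fin m → Fin n) → Injective _≡_ _≡_ f → (∀ x → f x ∈ₛ T) → m ≤ ∣ T ∣
injective⇒≤∣∣ {m = zero}  T f inj f∈T = z≤n
injective⇒≤∣∣ {m = suc m} T f inj f∈T = ≤-trans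
  (s≤s (injective⇒≤∣∣ (T - f zero) (f ∘ suc) (suc-injective ∘ inj)
    λ x → x∈p∧x≢y⇒x∈p-y (f∈T (suc x)) λ eq → 0≢1+n (sym (inj eq))))
  (x∈p⇒∣p-x∣<∣p∣ (f∈T zero))

Covers : Pred (Fin n) 0ℓ → (Fin c → Fin n) → Set
Covers V y = ∀ v → V v → ∃ λ x → y x ≡ v

-- Points are chosen greedily: a vertex of `V` missed so far is added, which keeps `y` injective.
-- Once none is missed, `y` covers `V`, and `v₀` pads the remaining entries.
cover-or-inject : ∀ c {V : Pred (Fin n) 0ℓ} → Decidable V → ∃ V →
                  ∃ λ (y : Fin c → Fin n) → (∀ x → V (y x)) × (Covers V y ⊎ Injective _≡_ _≡_ y)
cover-or-inject zero V? _ = (λ ()) , (λ ()) , inj₂ λ {}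
cover-or-inject {n = n} (suc c) {V} V? (v₀ , v₀∈V)
  with y , y∈V , dich ← cover-or-inject c V? (v₀ , v₀∈V)
  with any? (λ v → V? v ×-dec ¬? (any? λ x → y x ≟ v))
... | no all-hit = extend , extend∈V , inj₁ covers
  where
  extend : Fin (suc c) → Fin n
  extend zero    = v₀
  extend (suc x) = y x
  extend∈V : ∀ x → V (extend x)
  extend∈V zero    = v₀∈V
  extend∈V (suc x) = y∈V x
  covers : Covers V extend
  covers v v∈V with any? (λ x → y x ≟ v)
  ... | yes (x , yx≡v) = suc x , yx≡v
  ... | no missed      = contradiction (v , v∈V , missed) all-hit
... | yes (v , v∈V , missed) = extend , extend∈V , inj₂ (extend-inj dich)
  where
  extend : Fin (suc c) → Fin n
  extend zero    = v
  extend (suc x) = y x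
  extend∈V : ∀ x → V (extend x)
  extend∈V zero    = v∈V
  extend∈V (suc x) = y∈V x
  extend-inj : Covers V y ⊎ Injective _≡_ _≡_ y → Injective _≡_ _≡_ extend
  extend-inj (inj₁ covers) = contradiction (covers v v∈V) missed
  extend-inj (inj₂ inj) {zero}  {zero}   _  = refl
  extend-inj (inj₂ inj) {zero}  {suc x′} eq = contradiction (x′ , sym eq) missed
  extend-inj (inj₂ inj) {suc x} {zero}   eq = contradiction (x , eq) missed
  extend-inj (inj₂ inj) {suc x} {suc x′} eq = cong suc (inj eq)

-- Decoding `funToFin f` returns `f` only pointwise, which is enough because `Q` is tested at one
-- index at a time.
funToFin-choice : (Q : Fin l → Fin m → Set) → (∀ i → ∃ (Q i)) →
                  Σ (Fin (m ^ l)) λ a → ∀ i → Q i (finToFun a i)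
funToFin-choice Q choose =
  funToFin f , λ i → subst (Q i) (sym (finToFun-funToFin f i)) (proj₂ (choose i))
  where f = proj₁ ∘ choose

-- Adjacency in c-closed graphs.

Adj? : (G : Graph n) (u v : Fin n) → Dec (Adj G u v)
Adj? G u v = adj G u v Bool.≟ _

Adj-sym : (G : Graph n) {u v : Fin n} → Adj G u v → Adj G v u
Adj-sym G {u} {v} uv = trans (adj-sym G v u) uv

Adj-irrefl : (G : Graph n) {v : Fin n} → ¬ Adj G v v
Adj-irrefl G {v} vv = case trans (sym vv) (irrefl G v) of λ ()

-- The `c` distinct values of `y` are common neighbours of `u` and `w`, too many for a non-adjacent
-- pair.
closed⇒Adj : (G : Graph n) → CClosed c G → ∀ {u w} → u ≢ w → (y : Fin c → Fin n) → Injective _≡_ _≡_ y →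
             (∀ x → Adj G u (y x)) → (∀ x → Adj G w (y x)) → Adj G u w
closed⇒Adj G closed {u} {w} u≢w y inj uy wy = decidable-stable (Adj? G u w) λ ¬uw →
  <⇒≱ (closed u w u≢w (¬-not ¬uw))
    (injective⇒≤∣∣ (tabulate common) y inj λ x →
      lookup⇒[]= (y x) _ (trans (lookup∘tabulate common (y x)) (cong₂ _∧_ (uy x) (wy x))))
  where
  common = λ v → adj G u v ∧ adj G w v

-- Kinds, codes and decoding of parts.

pattern small  = zero
pattern clique = suc zero
pattern free   = suc (suc zero)

PartCode : ℕ → ℕ → ℕ
PartCode n c = 3 * n ^ c

kind : Fin (PartCode n c) → Fin 3
kind {n} {c} z = quotient {3} (n ^ c) z

points : Fin (PartCode n c) → Fin c → Fin n
points {n} {c} z = finToFun (remainder {3} (n ^ c) z)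

partCode : (t : Fin 3) (y : Fin c → Fin n) →
           Σ (Fin (PartCode n c)) λ z → kind {n} {c} z ≡ t × points {n} {c} z ≗ y
partCode {c} {n} t y = combine t (funToFin y) , cong proj₁ eq ,
  λ x → trans (cong (λ q → finToFun (proj₂ q) x) eq) (finToFun-funToFin y x)
  where eq = remQuot-combine {3} {n ^ c} t (funToFin y)

IsClique : Graph n → Pred (Fin n) 0ℓ → Set
IsClique G V = ∀ {u v} → V u → V v → u ≢ v → Adj G u v

-- That `y` takes its values in `V` is recorded separately in `Describes`. The non-adjacent pair
-- kept by `is-free` serves twice: it excludes `i` from `U`, and it forces the neighbouring parts to
-- be small.
data HasKind (G : Graph n) (V : Pred (Fin n) 0ℓ) : Fin 3 → (Fin c → Fin n) → Set where
  is-small  : ∀ {y : Fin c → Fin n} → Covers V y → HasKind G V small y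
  is-clique : ∀ {y : Fin c → Fin n} → Injective _≡_ _≡_ y → IsClique G V → HasKind G V clique y
  is-free   : ∀ {y : Fin c → Fin n} → Injective _≡_ _≡_ y →
              ∀ {u w} → V u → V w → u ≢ w → ¬ Adj G u w → HasKind G V free y

Injective-resp-≗ : {y y′ : Fin c → Fin n} → y′ ≗ y → Injective _≡_ _≡_ y → Injective _≡_ _≡_ y′
Injective-resp-≗ y≗ inj {x} {x′} eq = inj (trans (sym (y≗ x)) (trans eq (y≗ x′)))

-- Needed because the points read back from a code agree with the chosen ones only pointwise.
HasKind-resp-≗ : ∀ {G : Graph n} {V t} {y y′ : Fin c → Fin n} → y′ ≗ y →
                 HasKind G V t y → HasKind G V t y′
HasKind-resp-≗ y≗ (is-small covers) =
  is-small λ v v∈V → let x , yx≡v = covers v v∈V in x , trans (y≗ x) yx≡v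
HasKind-resp-≗ y≗ (is-clique inj cl) = is-clique (Injective-resp-≗ y≗ inj) cl
HasKind-resp-≗ y≗ (is-free inj u∈V w∈V u≢w ¬uw) = is-free (Injective-resp-≗ y≗ inj) u∈V w∈V u≢w ¬uw

choose-kind : (G : Graph n) {V : Pred (Fin n) 0ℓ} → Decidable V → ∃ V →
              ∃₂ λ t (y : Fin c → Fin n) → (∀ x → V (y x)) × HasKind G V t y
choose-kind {c = c} G {V} V? V≢∅ with cover-or-inject c V? V≢∅
... | y , y∈V , inj₁ covers = small , y , y∈V , is-small covers
... | y , y∈V , inj₂ inj
  with any? (λ u → any? λ w → V? u ×-dec V? w ×-dec ¬? (u ≟ w) ×-dec ¬? (Adj? G u w))
... | yes (u , w , u∈V , w∈V , u≢w , ¬uw) = free , y , y∈V , is-free inj u∈V w∈V u≢w ¬uw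
... | no ∄ = clique , y , y∈V , is-clique inj λ {u} {w} u∈V w∈V u≢w →
  decidable-stable (Adj? G u w) λ ¬uw → ∄ (u , w , u∈V , w∈V , u≢w , ¬uw)

Describes : Graph n → Pred (Fin n) 0ℓ → Fin (PartCode n c) → Set
Describes {n} {c} G V z =
  (∀ x → V (points {n} {c} z x)) × HasKind G V (kind {n} {c} z) (points {n} {c} z)

describe : (G : Graph n) {V : Pred (Fin n) 0ℓ} → Decidable V → ∃ V → ∃ (Describes {n} {c} G V)
describe {n} {c} G {V} V? V≢∅ =
  let t , y , y∈V , hasKind = choose-kind G V? V≢∅
      z , t≡ , y≗           = partCode t y
  in z , (λ x → subst V (sym (y≗ x)) (y∈V x)) ,
     subst (λ s → HasKind G V s (points {n} {c} z)) (sym t≡) (HasKind-resp-≗ y≗ hasKind)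

-- Neither `S` nor the assignment `p` occurs here, so a code alone determines the set. In
-- `from-free` only small neighbouring parts are consulted, since their recorded points exhaust
-- them.
data Decoded (G : Graph n) (H : Graph l) (t : Fin l → Fin 3) (y : Fin l → Fin c → Fin n)
             (w : Fin n) : Set where
  recorded    : ∀ i x → y i x ≡ w → Decoded G H t y w
  from-clique : ∀ i → t i ≡ clique → (∀ x → Adj G w (y i x)) → Decoded G H t y w
  from-free   : ∀ i → t i ≡ free →
                (∀ {j} → Adj H i j → t j ≡ small → ∀ x → Adj G w (y j x)) → Decoded G H t y w

-- Enlarging a blow-up by one vertex, and recovery of a maximal one.

module _ (G : Graph n) (closed : CClosed c G) (P : Pattern) {S : Subset n} where

  private
    Part : (Fin n → Fin (k P)) → Fin (k P) → Pred (Fin n) 0ℓ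
    Part p i v = v ∈ₛ S × p v ≡ i

  module _ (p : Fin n → Fin (k P))
           (nonempty : ∀ i → ∃ λ v → v ∈ₛ S × p v ≡ i)
           (complete : ∀ u v → u ∈ₛ S → v ∈ₛ S → u ≢ v → Adj (H P) (p u) (p v) → Adj G u v)
           (cliques : ∀ u v → u ∈ₛ S → v ∈ₛ S → u ≢ v → p u ≡ p v → p u ∈ₛ U P → Adj G u v)
           where

    parts-complete : ∀ {i j u v} → Adj (H P) i j → Part p i u → Part p j v → Adj G u v
    parts-complete {u = u} {v} ij (u∈S , refl) (v∈S , refl) =
      complete u v u∈S v∈S (λ { refl → Adj-irrefl (H P) ij }) ij

    -- The new vertex joins part `i`. Pairs of old vertices keep their parts, so only pairs
    -- containing `w` require the two adjacency hypotheses.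
    insert : ∀ {w} i → w ∉ₛ S →
             (∀ {j v} → Adj (H P) i j → Part p j v → Adj G w v) →
             (i ∈ₛ U P → ∀ {v} → Part p i v → Adj G w v) →
             IsBlowUp G P (⁅ w ⁆ ∪ S)
    insert {w} i w∉S to-nbrs to-part = p′ , nonempty′ , complete′ , cliques′
      where
      p′ : Fin n → Fin (k P)
      -- `p` is total on `Fin n`, so it already gives `w` some arbitrary part, which has to be
      -- overridden.
      p′ v with v ≟ w
      ... | yes _ = i
      ... | no  _ = p v

      old : ∀ {v} → v ∈ₛ ⁅ w ⁆ ∪ S → v ≢ w → v ∈ₛ S
      old v∈ v≢w with x∈p∪q⁻ ⁅ w ⁆ S v∈
      ... | inj₁ v∈w = contradiction (x∈⁅y⁆⇒x≡y w v∈w) v≢w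
      ... | inj₂ v∈S = v∈S

      nonempty′ : ∀ i′ → ∃ λ v → v ∈ₛ ⁅ w ⁆ ∪ S × p′ v ≡ i′
      nonempty′ i′ with v , v∈S , pv≡i′ ← nonempty i′ = v , q⊆p∪q ⁅ w ⁆ S v∈S , p′v≡i′
        where
        p′v≡i′ : p′ v ≡ i′
        p′v≡i′ with v ≟ w
        ... | yes refl = contradiction v∈S w∉S
        ... | no  _    = pv≡i′

      complete′ : ∀ u v → u ∈ₛ ⁅ w ⁆ ∪ S → v ∈ₛ ⁅ w ⁆ ∪ S → u ≢ v → Adj (H P) (p′ u) (p′ v) → Adj G u v
      complete′ u v u∈ v∈ u≢v e with u ≟ w | v ≟ w
      ... | yes refl | yes refl = contradiction refl u≢v
      ... | yes refl | no  v≢w  = to-nbrs e (old v∈ v≢w , refl)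
      ... | no  u≢w  | yes refl = Adj-sym G (to-nbrs (Adj-sym (H P) e) (old u∈ u≢w , refl))
      ... | no  u≢w  | no  v≢w  = complete u v (old u∈ u≢w) (old v∈ v≢w) u≢v e

      cliques′ : ∀ u v → u ∈ₛ ⁅ w ⁆ ∪ S → v ∈ₛ ⁅ w ⁆ ∪ S → u ≢ v → p′ u ≡ p′ v → p′ u ∈ₛ U P → Adj G u v
      cliques′ u v u∈ v∈ u≢v e ∈U with u ≟ w | v ≟ w
      ... | yes refl | yes refl = contradiction refl u≢v
      ... | yes refl | no  v≢w  = to-part ∈U (old v∈ v≢w , sym e)
      ... | no  u≢w  | yes refl = Adj-sym G (to-part (subst (_∈ₛ U P) e ∈U) (old u∈ u≢w , e))
      ... | no  u≢w  | no  v≢w  = cliques u v (old u∈ u≢w) (old v∈ v≢w) u≢v e ∈U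

    module _ (maximal : ∀ S′ → S ⊂ S′ → ¬ IsBlowUp G P S′)
             (t : Fin (k P) → Fin 3) (y : Fin (k P) → Fin c → Fin n)
             (y∈ : ∀ i x → Part p i (y i x))
             (hasKind : ∀ i → HasKind G (Part p i) (t i) (y i))
             where

      hasKind′ : ∀ {i s} → t i ≡ s → HasKind G (Part p i) s (y i)
      hasKind′ {i} t≡ = subst (λ s → HasKind G (Part p i) s (y i)) t≡ (hasKind i)

      -- Otherwise `insert` would contradict maximality. The adjacency hypotheses may assume that
      -- `w` lies outside `S`; this makes `w` distinct from the vertices of `S`, as `closed⇒Adj`
      -- demands.
      insertable⇒∈ : ∀ {w} i →
                     (w ∉ₛ S → ∀ {j v} → Adj (H P) i j → Part p j v → Adj G w v) →
                     (w ∉ₛ S → i ∈ₛ U P → ∀ {v} → Part p i v → Adj G w v) →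
                     w ∈ₛ S
      insertable⇒∈ {w} i to-nbrs to-part = decidable-stable (w ∈? S) λ w∉S →
        maximal (⁅ w ⁆ ∪ S) (q⊆p∪q ⁅ w ⁆ S , w , p⊆p∪q S (x∈⁅x⁆ w) , w∉S)
          (insert i w∉S (to-nbrs w∉S) (to-part w∉S))

      clique-adj-points : ∀ i {v} → IsClique G (Part p i) → Part p i v →
                          (∃ λ x → y i x ≡ v) ⊎ (∀ x → Adj G v (y i x))
      clique-adj-points i {v} cl v∈ with any? (λ x → y i x ≟ v)
      ... | yes hit = inj₁ hit
      ... | no miss = inj₂ λ x → cl v∈ (y∈ i x) λ v≡ → miss (x , sym v≡)

      -- Part `j` is complete to part `i`, so an injective `y j` would give the non-adjacent `a` and
      -- `b` a full `c` common neighbours.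
      nbr-not-large : ∀ {i j a b} → Part p i a → Part p i b → a ≢ b → ¬ Adj G a b →
                       Adj (H P) i j → ¬ Injective _≡_ _≡_ (y j)
      nbr-not-large {j = j} a∈ b∈ a≢b ¬ab ij inj = ¬ab (closed⇒Adj G closed a≢b (y j) inj
        (λ x → parts-complete ij a∈ (y∈ j x)) (λ x → parts-complete ij b∈ (y∈ j x)))

      decoded⇒∈ : ∀ {w} → Decoded G (H P) t y w → w ∈ₛ S
      decoded⇒∈ (recorded i x refl) = proj₁ (y∈ i x)
      decoded⇒∈ {w} (from-clique i t≡ wy) with is-clique inj cl ← hasKind′ t≡ =
        insertable⇒∈ i
          -- A vertex of a neighbouring part is complete to part `i`, so it shares all of `y i` with
          -- `w`.
          (λ w∉S ij v∈ → adj-w w∉S v∈ λ x → Adj-sym G (parts-complete ij (y∈ i x) v∈))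
          (λ w∉S _ v∈ → to-part w∉S v∈)
        where
        adj-w : ∀ {j v} → w ∉ₛ S → Part p j v → (∀ x → Adj G v (y i x)) → Adj G w v
        adj-w w∉S (v∈S , _) = closed⇒Adj G closed (λ { refl → w∉S v∈S }) (y i) inj wy
        to-part : ∀ {v} → w ∉ₛ S → Part p i v → Adj G w v
        -- A vertex of part `i` is not adjacent to itself, so the recorded points are treated apart:
        -- `wy` already joins them to `w`.
        to-part w∉S v∈ with clique-adj-points i cl v∈
        ... | inj₁ (x , refl) = wy x
        ... | inj₂ vy         = adj-w w∉S v∈ vy
      decoded⇒∈ {w} (from-free i t≡ wy)
        with is-free _ {a} {b} a∈@(a∈S , refl) b∈@(b∈S , pb≡i) a≢b ¬ab ← hasKind′ t≡ =
        -- Part `i` contains the non-adjacent `a` and `b`, so `i` cannot belong to `U`.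
        insertable⇒∈ i (λ _ → to-nbrs) λ _ ∈U → contradiction (cliques a b a∈S b∈S a≢b (sym pb≡i) ∈U) ¬ab
        where
        to-nbrs : ∀ {j v} → Adj (H P) i j → Part p j v → Adj G w v
        -- Both other kinds make `y j` injective, which `nbr-not-large` forbids; so `j` is small and
        -- `v` is a recorded point.
        to-nbrs {j} {v} ij v∈ with t j in tj≡ | hasKind j
        ... | small  | is-small covers with x , refl ← covers v v∈ = wy ij tj≡ x
        ... | clique | is-clique inj _     = ⊥-elim (nbr-not-large a∈ b∈ a≢b ¬ab ij inj)
        ... | free   | is-free inj _ _ _ _ = ⊥-elim (nbr-not-large a∈ b∈ a≢b ¬ab ij inj)

      -- The kind of the part containing `w` selects the constructor; only in a clique part can two
      -- of them arise.
      ∈⇒decoded : ∀ {w} → w ∈ₛ S → Decoded G (H P) t y w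
      ∈⇒decoded {w} w∈S with t (p w) in t≡ | hasKind (p w)
      ... | small  | is-small covers with x , eq ← covers w (w∈S , refl) = recorded (p w) x eq
      ... | clique | is-clique _ cl with clique-adj-points (p w) cl (w∈S , refl)
      ...   | inj₁ (x , eq) = recorded (p w) x eq
      ...   | inj₂ wy       = from-clique (p w) t≡ wy
      ∈⇒decoded {w} w∈S | free | is-free _ _ _ _ _ =
        from-free (p w) t≡ λ {j} ij _ x → parts-complete ij (w∈S , refl) (y∈ j x)

-- One code for each maximal blow-up.

CodesIn : Graph n → (c : ℕ) (P : Pattern) → Fin (PartCode n c ^ k P) → Subset n → Set
CodesIn {n} G c P a S = ∀ w → (w ∈ₛ S → D w) × (D w → w ∈ₛ S)
  where D = Decoded G (H P) (kind {n} {c} ∘ finToFun a) (points {n} {c} ∘ finToFun a)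

CodesIn-functional : ∀ (G : Graph n) c P {a S T} → CodesIn G c P a S → CodesIn G c P a T → S ≡ T
CodesIn-functional G c P S≈ T≈ = ⊆-antisym (λ {w} w∈S → proj₂ (T≈ w) (proj₁ (S≈ w) w∈S))
                                           (λ {w} w∈T → proj₂ (S≈ w) (proj₁ (T≈ w) w∈T))

-- Each part is described on its own, and the `k P` descriptions are packed into a single number.
maximal-coded : (G : Graph n) → CClosed c G → (P : Pattern) → ∀ {S} →
                IsMaxBlowUp G P S → ∃ λ a → CodesIn G c P a S
maximal-coded {n} {c} G closed P {S} ((p , nonempty , complete , cliques) , maximal)
  with a , desc ← funToFin-choice (λ i → Describes {n} {c} G λ v → v ∈ₛ S × p v ≡ i)
                    (λ i → describe G (λ v → v ∈? S ×-dec p v ≟ i) (nonempty i))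
  = a , λ w → ∈⇒decoded G closed P p nonempty complete cliques maximal t y y∈ hasKind ,
              decoded⇒∈ G closed P p nonempty complete cliques maximal t y y∈ hasKind
  where
  y∈      = proj₁ ∘ desc
  hasKind = proj₂ ∘ desc
  t = kind {n} {c} ∘ finToFun a
  y = points {n} {c} ∘ finToFun a

-- Polynomial bounds and the final count.

_⊕_ : Poly → Poly → Poly
[]       ⊕ g        = g
(a ∷ f)  ⊕ []       = a ∷ f
(a ∷ f)  ⊕ (b ∷ g)  = a + b ∷ f ⊕ g

eval-⊕ : ∀ f g x → eval (f ⊕ g) x ≡ eval f x + eval g x
eval-⊕ []      g       x = refl
eval-⊕ (a ∷ f) []      x = sym (+-identityʳ _)
eval-⊕ (a ∷ f) (b ∷ g) x rewrite eval-⊕ f g x = lemma a b x (eval f x) (eval g x)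
  where
  lemma : ∀ a b x u v → a + b + x * (u + v) ≡ a + x * u + (b + x * v)
  lemma = solve-∀

monomial : ℕ → ℕ → Poly
monomial a d = replicate d 0 ++ a ∷ []

eval-monomial : ∀ a d x → eval (monomial a d) x ≡ a * x ^ d
eval-monomial a zero    x = trans (cong (a +_) (*-zeroʳ x)) (trans (+-identityʳ a) (sym (*-identityʳ a)))
eval-monomial a (suc d) x rewrite eval-monomial a d x = lemma a x (x ^ d)
  where
  lemma : ∀ a x u → x * (a * u) ≡ a * (x * u)
  lemma = solve-∀

^-distrib-* : ∀ a b d → (a * b) ^ d ≡ a ^ d * b ^ d
^-distrib-* a b zero    = refl
^-distrib-* a b (suc d) =
  trans (cong (a * b *_) (^-distrib-* a b d)) ([m*n]*[o*p]≡[m*o]*[n*p] a b (a ^ d) (b ^ d))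

-- The number of codes `(3 * n ^ c) ^ k P`, expanded as a monomial in `n`.
codes-poly : ℕ → Pattern → Poly
codes-poly c P = monomial (3 ^ k P) (c * k P)

eval-codes-poly : ∀ c P n → eval (codes-poly c P) n ≡ PartCode n c ^ k P
eval-codes-poly c P n = begin
  eval (codes-poly c P) n   ≡⟨ eval-monomial (3 ^ k P) (c * k P) n ⟩
  3 ^ k P * n ^ (c * k P)   ≡⟨ cong (3 ^ k P *_) (^-*-assoc n c (k P)) ⟨
  3 ^ k P * (n ^ c) ^ k P   ≡⟨ ^-distrib-* 3 (n ^ c) (k P) ⟨
  PartCode n c ^ k P        ∎
  where open ≡-Reasoning

poly-sum : List Poly → Poly
poly-sum = foldr _⊕_ []

-- Coefficients are natural numbers, so no summand can lower the total. This lets one polynomial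
-- serve the whole finite family.
eval≤eval-poly-sum : ∀ {f fs} → f ∈ fs → ∀ x → eval f x ≤ eval (poly-sum fs) x
eval≤eval-poly-sum {fs = g ∷ fs} f∈ x rewrite eval-⊕ g (poly-sum fs) x with f∈
... | here refl = m≤m+n _ _
... | there f∈′ = ≤-trans (eval≤eval-poly-sum f∈′ x) (m≤n+m _ (eval g x))

theorem4 : (c : ℕ) → 1 ≤ c → (ℋ : List Pattern) →
    Σ Poly λ f →
    ∀ (n : ℕ) (G : Graph n) → CClosed c G →
    ∀ (P : Pattern) → P ∈ ℋ →
    (L : List (Subset n)) → Unique L → All (IsMaxBlowUp G P) L →
    length L ≤ eval f n
theorem4 c _ ℋ = poly-sum (map (codes-poly c) ℋ) , λ n G closed P P∈ℋ L unique maximal → begin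
  length L                                     ≤⟨ length≤codes (CodesIn G c P)
                                                    (λ {a} → CodesIn-functional G c P {a}) unique
                                                    (All.map (maximal-coded G closed P) maximal) ⟩
  PartCode n c ^ k P                           ≡⟨ eval-codes-poly c P n ⟨
  eval (codes-poly c P) n                      ≤⟨ eval≤eval-poly-sum (∈-map⁺ (codes-poly c) P∈ℋ) n ⟩
  eval (poly-sum (map (codes-poly c) ℋ)) n     ∎
  where open ≤-Reasoning
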